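{- Let $g\in\Sigma$, $n\geq 0$, let $t$ be a second-order ground term whose only function variable is $F$, where $F$ has arity $n$, let $h_1,\ldots,h_n\geq 0$ be non-negative integers, and let $\sigma=\{F\mapsto\lambda x_1\ldots x_n.s\}$ be a substitution such that the individual variables of $s$ are among $x_1,\ldots,x_n$ and $\mathit{occ}_\Sigma(x_i,s)=h_i$ for all $1\leq i\leq n$. Then $$\mathit{occ}_\Sigma(g,t\sigma)=\mathit{occ}_\Sigma(g,s)\cdot\mathrm{mul}[F,\overline{h_n},t]+\mathrm{cnt}[F,\overline{h_n},g,t].$$
   Context: $\Sigma$ is a signature of function symbols with fixed arities (arity $0$ symbols are constants). Terms are built from $\Sigma$, individual variables, and function variables; a function variable of arity $n$ is applied to $n$ argument terms. A second-order ground term is a term with no individual variables and containing at least one function variable, all its function variables having the same arity. $\overline{h_n}$ abbreviates $h_1,\ldots,h_n$. $\mathit{occ}_\Sigma(c,t)$ is the number of occurrences of the symbol or variable $c$ in the term $t$. In $\sigma=\{F\mapsto\lambda x_1\ldots x_n.s\}$, the term $s$ contains no function variables. $t\sigma$ is taken in $\beta$-normal form: $F(t_1,\ldots,t_n)\sigma$ is the result of simultaneously replacing each $x_i$ in $s$ by $t_i\sigma$, and $f(t_1,\ldots,t_l)\sigma=f(t_1\sigma,\ldots,t_l\sigma)$ for $f\in\Sigma$. The following are defined recursively on terms $t$ with no individual variables and no function variable other than $F$ (of arity $n$). $n$-multiplier $\mathrm{mul}[F,\overline{h_n},t]$: it is $0$ if $t$ is a constant; $\mathrm{mul}[F,\overline{h_n},f(t_1,\ldots,t_l)]=\sum_{j=1}^l\mathrm{mul}[F,\overline{h_n},t_j]$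 for $f\in\Sigma$; $\mathrm{mul}[F,\overline{h_n},F(t_1,\ldots,t_n)]=1+\sum_{i=1}^n h_i\cdot\mathrm{mul}[F,\overline{h_n},t_i]$. $n$-counter $\mathrm{cnt}[F,\overline{h_n},g,t]$ for $g\in\Sigma$: for $f\in\Sigma$ of arity $l\geq 0$, $\mathrm{cnt}[F,\overline{h_n},g,f(t_1,\ldots,t_l)]=\delta+\sum_{j=1}^l\mathrm{cnt}[F,\overline{h_n},g,t_j]$, where $\delta=1$ if $f=g$ and $\delta=0$ otherwise; $\mathrm{cnt}[F,\overline{h_n},g,F(t_1,\ldots,t_n)]=\sum_{i=1}^n h_i\cdot\mathrm{cnt}[F,\overline{h_n},g,t_i]$. -}

module Defs where

import Algebra.Properties.Semiring.Sum as SemiringSum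
open import Data.Bool.Base using (if_then_else_)
open import Data.Fin.Base using (Fin)
open import Data.Fin.Properties using (any?)
open import Data.Nat.Base using (ℕ; _+_; _*_; _<_)
open import Data.Nat.Properties using (+-*-semiring)
open import Data.Product.Base using (_,_; ∃)
open import Data.Vec.Functional using (Vector)
open import Function.Definitions using (Injective)
open import Relation.Binary.Definitions using (DecidableEquality)
open import Relation.Binary.PropositionalEquality using (_≡_; refl)
open import Relation.Nullary.Decidable using (does; yes; no)

open SemiringSum +-*-semiring using (sum-syntax)

record Language : Set₁ where
  field
    Sym    : Set
    IVar   : Set
    FVar   : Set
    arity  : Sym → ℕ
    farity : FVar → ℕ
    _≟ₛ_   : DecidableEquality Sym
    _≟ᵢ_   : DecidableEquality IVar
    _≟ᶠ_   : DecidableEquality FVar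

module Terms (L : Language) where
  open Language L

  data Term : Set where
    var : IVar → Term
    fun : (f : Sym) → Vector Term (arity f) → Term
    app : (G : FVar) → Vector Term (farity G) → Term

  data Letter : Set where
    sym  : Sym → Letter
    ivar : IVar → Letter
    fvar : FVar → Letter

  δ : Letter → Letter → ℕ
  δ (sym f)  (sym g)  = if does (f ≟ₛ g) then 1 else 0
  δ (ivar x) (ivar y) = if does (x ≟ᵢ y) then 1 else 0
  δ (fvar F) (fvar G) = if does (F ≟ᶠ G) then 1 else 0
  δ _        _        = 0

  occ : Letter → Term → ℕ
  occ c (var x)    = δ (ivar x) c
  occ c (fun f ts) = δ (sym f) c + ∑[ j < arity f ] occ c (ts j)
  occ c (app G ts) = δ (fvar G) c + ∑[ i < farity G ] occ c (ts i)

  record SecondOrderGround (t : Term) : Set where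
    field
      noIVar    : ∀ x → occ (ivar x) t ≡ 0
      someFVar  : ∃ λ G → 0 < occ (fvar G) t
      sameArity : ∀ G H → 0 < occ (fvar G) t → 0 < occ (fvar H) t →
                  farity G ≡ farity H

  -- Terms without individual variables and without function variables
  -- other than F, the common domain of the multiplier and the counter.
  -- F itself need not occur, since subterms of such a term may avoid it.
  data Over (F : FVar) : Term → Set where
    fun : ∀ {f ts} → (∀ j → Over F (ts j)) → Over F (fun f ts)
    app : ∀ {ts}   → (∀ i → Over F (ts i)) → Over F (app F ts)

  -- {F ↦ λ x₁ … xₙ . s}, with n the arity of F.
  record Substitution (F : FVar) : Set where
    field
      params   : Vector IVar (farity F)
      distinct : Injective _≡_ _≡_ params
      body     : Term
      noFVar   : ∀ G → occ (fvar G) body ≡ 0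

  replace : ∀ {n} → Vector IVar n → Vector Term n → Term → Term
  replace xs ts (var y) with any? (λ i → y ≟ᵢ xs i)
  ... | yes (i , _) = ts i
  ... | no _        = var y
  replace xs ts (fun f ss) = fun f (λ j → replace xs ts (ss j))
  replace xs ts (app G ss) = app G (λ j → replace xs ts (ss j))

  -- The β-normal form of tσ. The body of σ has no binders and no function
  -- variables, so one pass of replacement leaves no redex and no variable
  -- can be captured.
  apply : ∀ {F} → Substitution F → Term → Term
  apply σ (var y)    = var y
  apply σ (fun f ts) = fun f (λ j → apply σ (ts j))
  apply {F} σ (app G ts) with G ≟ᶠ F
  ... | yes refl = replace params (λ i → apply σ (ts i)) body
    where open Substitution σ
  ... | no _     = app G (λ i → apply σ (ts i))

  -- For a constant the sum is empty, so the multiplier is 0.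
  mul : (F : FVar) → Vector ℕ (farity F) → (t : Term) → Over F t → ℕ
  mul F h (fun f ts) (fun os) = ∑[ j < arity f ] mul F h (ts j) (os j)
  mul F h (app _ ts) (app os) =
    1 + ∑[ i < farity F ] (h i * mul F h (ts i) (os i))

  cnt : (F : FVar) → Vector ℕ (farity F) → Sym → (t : Term) → Over F t → ℕ
  cnt F h g (fun f ts) (fun os) =
    δ (sym f) (sym g) + ∑[ j < arity f ] cnt F h g (ts j) (os j)
  cnt F h g (app _ ts) (app os) =
    ∑[ i < farity F ] (h i * cnt F h g (ts i) (os i))

{-# OPTIONS --safe #-}
-- Replacing distinct variables xᵢ by terms rᵢ in s keeps the occurrences of g
-- in s and adds those in rᵢ once per occurrence of xᵢ. With rᵢ = tᵢσ, each F in t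
-- thus contributes occ(g,s) and scales the contributions of its i-th argument
-- by hᵢ, which is the recursion of mul and cnt; conclude by induction on t.
module Submission where

open import Defs
import Algebra.Properties.Semiring.Sum as SemiringSum
open import Data.Bool.Base using (if_then_else_)
open import Data.Empty using (⊥-elim)
open import Data.Fin.Base using (Fin; zero; suc)
open import Data.Fin.Properties using (any?; suc-injective)
open import Data.Nat.Base using (ℕ; _+_; _*_; _<_)
open import Data.Nat.Properties
  using (+-*-semiring; +-identityʳ; +-assoc; *-identityˡ)
open import Data.Nat.Tactic.RingSolver using (solve-∀)
open import Data.Product.Base using (∃; _,_)
open import Data.Vec.Functional using (Vector)
open import Function.Base using (_∘_)
open import Function.Definitions using (Injective)
open import Relation.Binary.PropositionalEquality
  using (_≡_; _≢_; refl; trans; cong; cong₂; module ≡-Reasoning)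
  renaming (sym to ≡-sym)
open import Relation.Nullary.Decidable using (yes; no; dec-true; dec-false)

open SemiringSum +-*-semiring
  using (sum; sum-syntax; sum-cong-≗; sum-replicate-zero; ∑-distrib-+; ∑-comm;
         *-distribˡ-sum; *-distribʳ-sum)
open ≡-Reasoning

∑-zero : ∀ {n} (f : Vector ℕ n) → (∀ i → f i ≡ 0) → sum f ≡ 0
∑-zero {n} f f≗0 = trans (sum-cong-≗ f≗0) (sum-replicate-zero n)

∑-single : ∀ {n} (f : Vector ℕ n) k → (∀ i → i ≢ k → f i ≡ 0) → sum f ≡ f k
∑-single f zero    f≡0 =
  trans (cong (f zero +_) (∑-zero (f ∘ suc) λ i → f≡0 (suc i) λ ()))
        (+-identityʳ (f zero))
∑-single f (suc k) f≡0 =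
  cong₂ _+_ (f≡0 zero λ ())
            (∑-single (f ∘ suc) k λ i i≢k → f≡0 (suc i) (i≢k ∘ suc-injective))

-- Both cases of the induction on `t` sum values of the form `b * m + k` over the arguments, with
-- `b` the fixed count of `g` in the body. Splitting such a sum separates the `mul` part from the
-- `cnt` part.
∑-linear : ∀ {n} b (u v : Vector ℕ n) →
           ∑[ i < n ] (b * u i + v i) ≡ b * sum u + sum v
∑-linear b u v =
  trans (∑-distrib-+ (λ i → b * u i) v)
        (cong (_+ sum v) (≡-sym (*-distribˡ-sum b u)))

module _ (L : Language) where
  open Language L
  open Terms L

  δ-ivar-≡ : ∀ {x y} → x ≡ y → δ (ivar x) (ivar y) ≡ 1
  δ-ivar-≡ {x} {y} x≡y =
    cong (λ b → if b then 1 else 0) (dec-true (x ≟ᵢ y) x≡y)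

  δ-ivar-≢ : ∀ {x y} → x ≢ y → δ (ivar x) (ivar y) ≡ 0
  δ-ivar-≢ {x} {y} x≢y =
    cong (λ b → if b then 1 else 0) (dec-false (x ≟ᵢ y) x≢y)

  module _ (g : Sym) {n} (xs : Vector IVar n) (distinct : Injective _≡_ _≡_ xs)
           (ts : Vector Term n) where

    private
      c : Vector ℕ n
      c i = occ (sym g) (ts i)

    -- The inductive step of `occ-replace`, shared by `fun` and `app` nodes. Only the contribution
    -- `d` of the head differs, and replacement leaves the head unchanged.
    ∑-occ-args : ∀ {l} d (ss : Vector Term l) →
      (∀ j → occ (sym g) (replace xs ts (ss j)) ≡
             occ (sym g) (ss j) + ∑[ i < n ] (occ (ivar (xs i)) (ss j) * c i)) →
      d + ∑[ j < l ] occ (sym g) (replace xs ts (ss j)) ≡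
      (d + ∑[ j < l ] occ (sym g) (ss j)) +
        ∑[ i < n ] ((∑[ j < l ] occ (ivar (xs i)) (ss j)) * c i)
    ∑-occ-args {l} d ss ih = begin
      d + ∑[ j < l ] occ (sym g) (replace xs ts (ss j))
        ≡⟨ cong (d +_) (sum-cong-≗ ih) ⟩
      d + ∑[ j < l ] (occ (sym g) (ss j) + ∑[ i < n ] a i j)
        ≡⟨ cong (d +_) (∑-distrib-+ (λ j → occ (sym g) (ss j)) (λ j → ∑[ i < n ] a i j)) ⟩
      d + (p + ∑[ j < l ] ∑[ i < n ] a i j)
        ≡⟨ +-assoc d p _ ⟨
      (d + p) + ∑[ j < l ] ∑[ i < n ] a i j
        -- With the sum over parameters outermost, `c i` does not depend on the inner index `j` and
        -- factors out.
        ≡⟨ cong (d + p +_) (∑-comm (λ j i → a i j)) ⟩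
      (d + p) + ∑[ i < n ] ∑[ j < l ] a i j
        ≡⟨ cong (d + p +_) (sum-cong-≗ λ i →
             *-distribʳ-sum (c i) (λ j → occ (ivar (xs i)) (ss j))) ⟨
      (d + p) + ∑[ i < n ] ((∑[ j < l ] occ (ivar (xs i)) (ss j)) * c i) ∎
      where
      p = ∑[ j < l ] occ (sym g) (ss j)
      a : Fin n → Fin l → ℕ
      a i j = occ (ivar (xs i)) (ss j) * c i

    occ-replace : ∀ s →
      occ (sym g) (replace xs ts s) ≡
      occ (sym g) s + ∑[ i < n ] (occ (ivar (xs i)) s * occ (sym g) (ts i))
    occ-replace (var y) with any? (λ i → y ≟ᵢ xs i)
    -- The variable itself contributes no `g`, so only the sum remains on the right. Since the
    -- parameters are distinct, `k` is the only index whose parameter equals `y`.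
    ... | yes (k , y≡xₖ) = ≡-sym (begin
      ∑[ i < n ] (δ (ivar y) (ivar (xs i)) * c i)
        ≡⟨ ∑-single _ k (λ i i≢k → cong (_* c i)
             (δ-ivar-≢ λ y≡xᵢ → i≢k (distinct (trans (≡-sym y≡xᵢ) y≡xₖ)))) ⟩
      δ (ivar y) (ivar (xs k)) * c k
        ≡⟨ cong (_* c k) (δ-ivar-≡ y≡xₖ) ⟩
      1 * c k
        ≡⟨ *-identityˡ (c k) ⟩
      c k ∎)
    ... | no y∉xs = ≡-sym (∑-zero _ λ i →
      cong (_* c i) (δ-ivar-≢ λ y≡xᵢ → y∉xs (i , y≡xᵢ)))
    -- A head symbol is never an individual variable, so `occ (ivar (xs i)) (fun f ss)` computes to
    -- the bare sum over the arguments.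
    occ-replace (fun f ss) =
      ∑-occ-args (δ (sym f) (sym g)) ss (λ j → occ-replace (ss j))
    occ-replace (app G ss) =
      -- Here `d` is `0`, because a function variable never counts as the symbol `g`.
      ∑-occ-args 0 ss (λ j → occ-replace (ss j))

  -- `apply` is stuck on the test `F ≟ᶠ F` until its outcome is inspected.
  apply-app : ∀ {F} (σ : Substitution F) (ts : Vector Term (farity F)) →
    let open Substitution σ in
    apply σ (app F ts) ≡ replace params (λ i → apply σ (ts i)) body
  apply-app {F} σ ts with F ≟ᶠ F
  ... | yes refl = refl
  ... | no F≢F   = ⊥-elim (F≢F refl)

  module _ (g : Sym) {F : FVar} (h : Vector ℕ (farity F)) (σ : Substitution F)
           (occ-params : ∀ i → occ (ivar (Substitution.params σ i)) (Substitution.body σ) ≡ h i)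
    where
    open Substitution σ

    -- Induction on the derivation `o`, which rules out individual variables and function variables
    -- other than `F`, leaving two cases.
    occ-apply : ∀ {t} (o : Over F t) →
      occ (sym g) (apply σ t) ≡
      occ (sym g) body * mul F h t o + cnt F h g t o
    occ-apply (fun {f} {ts} os) = begin
      d + ∑[ j < arity f ] occ (sym g) (apply σ (ts j))
        ≡⟨ cong (d +_) (sum-cong-≗ λ j → occ-apply (os j)) ⟩
      d + ∑[ j < arity f ] (b * m j + k j)
        ≡⟨ cong (d +_) (∑-linear b m k) ⟩
      d + (b * sum m + sum k)
        -- The head's contribution `d` joins the counter; a `fun` node adds nothing of its own to
        -- the multiplier.
        ≡⟨ rearrange d (b * sum m) (sum k) ⟩
      b * sum m + (d + sum k) ∎
      where
      b = occ (sym g) body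
      d = δ (sym f) (sym g)
      m k : Vector ℕ (arity f)
      m j = mul F h (ts j) (os j)
      k j = cnt F h g (ts j) (os j)
      rearrange : ∀ x y z → x + (y + z) ≡ y + (x + z)
      rearrange = solve-∀
    occ-apply (app {ts} os) = begin
      occ (sym g) (apply σ (app F ts))
        ≡⟨ cong (occ (sym g)) (apply-app σ ts) ⟩
      occ (sym g) (replace params (λ i → apply σ (ts i)) body)
        ≡⟨ occ-replace g params distinct (λ i → apply σ (ts i)) body ⟩
      b + ∑[ i < farity F ]
            (occ (ivar (params i)) body * occ (sym g) (apply σ (ts i)))
        -- The weights `h i` enter here: the i-th argument is copied once per occurrence of its
        -- parameter in the body.
        ≡⟨ cong (b +_) (sum-cong-≗ λ i → cong₂ _*_ (occ-params i) (occ-apply (os i))) ⟩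
      b + ∑[ i < farity F ] (h i * (b * m i + k i))
        ≡⟨ cong (b +_) (sum-cong-≗ λ i → distribute (h i) b (m i) (k i)) ⟩
      b + ∑[ i < farity F ] (b * (h i * m i) + h i * k i)
        ≡⟨ cong (b +_) (∑-linear b (λ i → h i * m i) (λ i → h i * k i)) ⟩
      b + (b * hm + hk)
        -- The leading `b`, from the copy of the body replacing this `F`, becomes the `1 +` in
        -- `mul`.
        ≡⟨ collect b hm hk ⟩
      b * (1 + hm) + hk ∎
      where
      b = occ (sym g) body
      m k : Vector ℕ (farity F)
      m i = mul F h (ts i) (os i)
      k i = cnt F h g (ts i) (os i)
      hm = ∑[ i < farity F ] (h i * m i)
      hk = ∑[ i < farity F ] (h i * k i)
      distribute : ∀ x y z w → x * (y * z + w) ≡ y * (x * z) + x * w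
      distribute = solve-∀
      collect : ∀ x y z → x + (x * y + z) ≡ x * (1 + y) + z
      collect = solve-∀

lemma3p6 :
    (L : Language) →
    let open Language L
        open Terms L
    in
    (g : Sym) (F : FVar)
    (t : Term) → SecondOrderGround t → (t-over-F : Over F t) →
    (h : Vector ℕ (farity F))
    (σ : Substitution F) →
    let open Substitution σ in
    (∀ y → 0 < occ (ivar y) body → ∃ λ i → y ≡ params i) →
    (∀ i → occ (ivar (params i)) body ≡ h i) →
    occ (sym g) (apply σ t) ≡
      occ (sym g) body * mul F h t t-over-F + cnt F h g t t-over-F
lemma3p6 L g F t _ t-over-F h σ _ occ-params = occ-apply L g h σ occ-params t-over-F
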